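{- For every Parikh vector $P \in \mathbb{N}_0^{\sigma}$ with $n = \sum_{a\in\Sigma} P[a] \geq 1$, the diameter of the configuration graph $G(P)$ equals $n - \max_{a \in \Sigma} P[a]$.
   Context: Alphabet $\Sigma = [\sigma]$. For $P \in \mathbb{N}_0^\sigma$, $n := \sum_a P[a]$ and $\Sigma^{*|_P}$ is the set of words of length $n$ over $\Sigma$ in which each symbol $a$ occurs exactly $P[a]$ times. For a word $w$ and $i\neq j$ with $w[i]\neq w[j]$, the 2-swap $w\circ(i,j)$ exchanges the symbols at positions $i$ and $j$. The configuration graph $G(P)$ has vertex set $\Sigma^{*|_P}$ and an edge $\{w,u\}$ whenever $u = w\circ(i,j)$ for some 2-swap. $G(P)$ is connected; its diameter is the maximum over pairs of vertices of their shortest-path distance. -}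

module Defs where

open import Data.Nat using (ℕ; zero; suc; _≤_; _⊔_)
open import Data.Fin using (Fin)
open import Data.Fin.Properties using (_≟_)
open import Data.Vec using (Vec; lookup; tabulate; count; sum; foldr′; _[_]≔_)
open import Data.Product using (Σ-syntax; ∃-syntax; _×_; proj₁)
open import Level using (0ℓ)
open import Relation.Binary.Core using (Rel)
open import Relation.Binary.PropositionalEquality using (_≡_; _≢_)
open import Relation.Binary.Construct.Closure.ReflexiveTransitive using (Star; ε; _◅_)

module _ {V : Set} (_~_ : Rel V 0ℓ) where

  Walk : V → V → Set
  Walk = Star _~_

  walkLength : ∀ {u v} → Walk u v → ℕ
  walkLength ε       = zero
  walkLength (_ ◅ p) = suc (walkLength p)

  IsDistance : V → V → ℕ → Set
  IsDistance u v d =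
    (Σ[ p ∈ Walk u v ] walkLength p ≡ d) × ((p : Walk u v) → d ≤ walkLength p)

  -- The maximum of the distances.  The first component also says that every
  -- pair has a distance, so a disconnected graph has no diameter.
  IsDiameter : ℕ → Set
  IsDiameter D =
    (∀ u v → ∃[ d ] (IsDistance u v d × d ≤ D)) ×
    (∃[ u ] ∃[ v ] IsDistance u v D)

parikh : ∀ {σ n} → Vec (Fin σ) n → Vec ℕ σ
parikh w = tabulate (λ a → count (a ≟_) w)

-- Σ^{*|P}
Word : ∀ {σ} → Vec ℕ σ → Set
Word {σ} P = Σ[ w ∈ Vec (Fin σ) (sum P) ] parikh w ≡ P

_∘⟨_,_⟩ : ∀ {σ n} → Vec (Fin σ) n → Fin n → Fin n → Vec (Fin σ) n
w ∘⟨ i , j ⟩ = (w [ i ]≔ lookup w j) [ j ]≔ lookup w i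

-- The adjacency relation of G(P).  It is symmetric because every 2-swap is an
-- involution, so it describes an undirected graph.
ConfigurationGraph : ∀ {σ} (P : Vec ℕ σ) → Rel (Word P) 0ℓ
ConfigurationGraph {σ} P w u =
  Σ[ i ∈ Fin (sum P) ] Σ[ j ∈ Fin (sum P) ]
    i ≢ j × lookup (proj₁ w) i ≢ lookup (proj₁ w) j × proj₁ u ≡ proj₁ w ∘⟨ i , j ⟩

-- The seed 0 is harmless: the entries are natural numbers.
maximum : ∀ {σ} → Vec ℕ σ → ℕ
maximum = foldr′ _⊔_ 0

{-# OPTIONS --safe #-}

-- Upper bound: let a be a most frequent symbol and call a position i of u bad
-- (with respect to the target v) if v[i] ≢ a and u[i] ≢ v[i].  As u and v have
-- the same Parikh vector, u ≢ v forces a bad position i, and some j has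
-- u[j] ≡ v[i] ≢ v[j].  Swapping i and j repairs i and cannot spoil j, so at
-- most n - P[a] swaps are needed.
--
-- Lower bound: a 2-swap changes the number of ascents {i | u[i] < v[i]} by at
-- most one, so the distance of u and v is at least this number.  If u is the
-- sorted word and v its rotation by m = max P, then each of the first n - m
-- positions is an ascent, because every block of equal letters has length ≤ m.
module Submission where

open import Defs
open import Data.Nat using (ℕ; _≥_; _∸_)
open import Data.Vec using (Vec; sum)

open import Data.Bool using (true; false; if_then_else_)
open import Data.Fin using (Fin; zero; suc; punchIn; punchOut) renaming (_<_ to _<ᶠ_; _≤_ to _≤ᶠ_)
open import Data.Fin.Properties using (_≟_; _<?_; any?; ≤-total; punchIn-punchOut; punchIn-injective; punchInᵢ≢i)
open import Data.List as List using (List; []; _∷_; _++_; length; replicate; filter; zip; take; drop)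
open import Data.List.Properties using (length-++; length-map; length-replicate; length-drop; filter-++; filter-all; filter-none; take++drop≡id; drop-drop; drop-map)
open import Data.List.Relation.Unary.All as All using (All; []; _∷_)
import Data.List.Relation.Unary.All.Properties as All
open import Data.Nat using (zero; suc; _+_; _≤_; _<_; z≤n; s≤s)
open import Data.Nat.Induction using (<-rec)
open import Data.Nat.Properties using (+-assoc; +-comm; +-suc; +-identityʳ; +-mono-≤; +-monoˡ-≤; ≤-refl; ≤-reflexive; ≤-trans; ≤-antisym; <-irrefl; <-≤-trans; ≤-<-trans; +-mono-<-≤; +-mono-≤-<; ≮⇒≥; ⊔-sel; m⊔n≤o⇒m≤o; m⊔n≤o⇒n≤o; m+n∸n≡m; m+[n∸m]≡n; anyUpTo?; module ≤-Reasoning)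
import Data.Nat.Properties as ℕ
open import Data.Product using (∃-syntax; Σ-syntax; _×_; _,_; proj₁; proj₂; uncurry)
open import Data.Sum using (_⊎_; inj₁; inj₂)
open import Data.Vec using ([]; _∷_; lookup; count; fromList; cast; _[_]≔_)
open import Data.Vec.Properties using (≡-dec; lookup∘tabulate; tabulate∘lookup; tabulate-cong; lookup∘update; lookup∘update′)
open import Function using (_∘_)
open import Level using (0ℓ)
open import Relation.Binary.Core using (Rel)
open import Relation.Binary.Definitions using (DecidableEquality)
open import Relation.Binary.Construct.Closure.ReflexiveTransitive using (ε; _◅_)
open import Relation.Binary.PropositionalEquality using (_≡_; _≢_; refl; sym; trans; cong; cong₂; subst; module ≡-Reasoning)
open import Relation.Binary.PropositionalEquality.WithK using (≡-irrelevant)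
open import Relation.Nullary using (¬_; Dec; yes; no; does; contradiction)
open import Relation.Nullary.Decidable using (map′; ¬?; _×-dec_; decidable-stable)
open import Algebra.Properties.CommutativeMonoid.Sum ℕ.+-0-commutativeMonoid using (sum-remove; sum-cong-≗; ∑-distrib-+) renaming (sum to ∑)

-- Indicators and finite sums

𝟙 : {A : Set} → Dec A → ℕ
𝟙 a? = if does a? then 1 else 0

𝟙≤1 : {A : Set} (a? : Dec A) → 𝟙 a? ≤ 1
𝟙≤1 (yes _) = ≤-refl
𝟙≤1 (no _)  = z≤n

𝟙-mono : {A B : Set} (a? : Dec A) (b? : Dec B) → (A → B) → 𝟙 a? ≤ 𝟙 b?
𝟙-mono (no _)  _        _   = z≤n
𝟙-mono (yes _) (yes _)  _   = ≤-refl
𝟙-mono (yes a) (no ¬b)  a⇒b = contradiction (a⇒b a) ¬b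

𝟙-true : {A : Set} (a? : Dec A) → A → 𝟙 a? ≡ 1
𝟙-true (yes _) _ = refl
𝟙-true (no ¬a) a = contradiction a ¬a

𝟙-false : {A : Set} (a? : Dec A) → ¬ A → 𝟙 a? ≡ 0
𝟙-false (yes a) ¬a = contradiction a ¬a
𝟙-false (no _)  _  = refl

𝟙-<⇒ : {A B : Set} (a? : Dec A) (b? : Dec B) → 𝟙 a? < 𝟙 b? → ¬ A × B
𝟙-<⇒ (no ¬a) (yes b) _        = ¬a , b
𝟙-<⇒ (no _)  (no _)  ()
𝟙-<⇒ (yes _) (yes _) (s≤s ())
𝟙-<⇒ (yes _) (no _)  ()

∑-mono-≤ : ∀ {n} {g h : Fin n → ℕ} → (∀ i → g i ≤ h i) → ∑ g ≤ ∑ h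
∑-mono-≤ {zero}  _   = z≤n
∑-mono-≤ {suc n} g≤h = +-mono-≤ (g≤h zero) (∑-mono-≤ (g≤h ∘ suc))

∑-mono-< : ∀ {n} {g h : Fin n → ℕ} → (∀ i → g i ≤ h i) → ∀ i → g i < h i → ∑ g < ∑ h
∑-mono-< g≤h zero    g<h = +-mono-<-≤ g<h (∑-mono-≤ (g≤h ∘ suc))
∑-mono-< g≤h (suc i) g<h = +-mono-≤-< (g≤h zero) (∑-mono-< (g≤h ∘ suc) i g<h)

-- If no such `j` existed, `g ≤ h` would hold everywhere and strictly at `i`, so the sums would
-- differ.
∑-≡⇒∃> : ∀ {n} {g h : Fin n → ℕ} → ∑ g ≡ ∑ h → ∀ i → g i < h i → ∃[ j ] h j < g j
∑-≡⇒∃> {g = g} {h} eq i g<h with any? (λ j → h j ℕ.<? g j)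
... | yes found = found
... | no  none  = contradiction (∑-mono-< (λ j → ≮⇒≥ (λ h<g → none (j , h<g))) i g<h) (<-irrefl eq)

∑-ones : ∀ n → ∑ {n} (λ _ → 1) ≡ n
∑-ones zero    = refl
∑-ones (suc n) = cong suc (∑-ones n)

-- The common remainder `r` is the sum over all other indices. Having it shared by both equations
-- reduces a comparison of the sums to a comparison of two terms each.
∑-agree-off-two : ∀ {n} {g h : Fin n → ℕ} {i j} → i ≢ j → (∀ k → k ≢ i → k ≢ j → g k ≡ h k) →
                  ∃[ r ] (∑ g ≡ (g i + g j) + r × ∑ h ≡ (h i + h j) + r)
∑-agree-off-two {suc zero}    {i = zero} {zero} i≢j _ = contradiction refl i≢j
∑-agree-off-two {suc (suc n)} {g} {h} {i} {j} i≢j agree =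
  ∑ (g ∘ skip) , split g , trans (split h) (cong (h i + h j +_) (sum-cong-≗ (sym ∘ same)))
  where
  -- The index that `j` receives once `i` is removed, so that `skip` runs through the indices other
  -- than `i` and `j`.
  j′ : Fin (suc n)
  j′ = punchOut i≢j

  skip : Fin n → Fin (suc (suc n))
  skip k = punchIn i (punchIn j′ k)

  same : ∀ k → g (skip k) ≡ h (skip k)
  same k = agree (skip k) (punchInᵢ≢i i _)
    (λ eq → punchInᵢ≢i j′ k (punchIn-injective i _ _ (trans eq (sym (punchIn-punchOut i≢j)))))

  split : ∀ f → ∑ f ≡ (f i + f j) + ∑ (f ∘ skip)
  split f = begin
    ∑ f                                          ≡⟨ sum-remove {i = i} f ⟩
    f i + ∑ (f ∘ punchIn i)                      ≡⟨ cong (f i +_) (sum-remove {i = j′} (f ∘ punchIn i)) ⟩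
    f i + (f (punchIn i j′) + ∑ (f ∘ skip))      ≡⟨ cong (λ x → f i + (f x + ∑ (f ∘ skip))) (punchIn-punchOut i≢j) ⟩
    f i + (f j + ∑ (f ∘ skip))                   ≡⟨ +-assoc (f i) (f j) _ ⟨
    (f i + f j) + ∑ (f ∘ skip)                   ∎
    where open ≡-Reasoning

lookup-ext : ∀ {A : Set} {n} {u v : Vec A n} → (∀ i → lookup u i ≡ lookup v i) → u ≡ v
lookup-ext {u = u} {v} eq = trans (sym (tabulate∘lookup u)) (trans (tabulate-cong eq) (tabulate∘lookup v))

count≡∑ : ∀ {σ n} (a : Fin σ) (w : Vec (Fin σ) n) → count (a ≟_) w ≡ ∑ (λ i → 𝟙 (a ≟ lookup w i))
count≡∑ a []      = refl
count≡∑ a (x ∷ w) with does (a ≟ x)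
... | true  = cong suc (count≡∑ a w)
... | false = count≡∑ a w

-- 2-swaps

module _ {σ n} (w : Vec (Fin σ) n) {i j : Fin n} where

  lookup-swapʳ : lookup (w ∘⟨ i , j ⟩) j ≡ lookup w i
  lookup-swapʳ = lookup∘update j (w [ i ]≔ lookup w j) (lookup w i)

  lookup-swapˡ : i ≢ j → lookup (w ∘⟨ i , j ⟩) i ≡ lookup w j
  lookup-swapˡ i≢j = trans (lookup∘update′ i≢j (w [ i ]≔ lookup w j) (lookup w i)) (lookup∘update i w (lookup w j))

  lookup-swap-other : ∀ k → k ≢ i → k ≢ j → lookup (w ∘⟨ i , j ⟩) k ≡ lookup w k
  lookup-swap-other k k≢i k≢j = trans (lookup∘update′ k≢j (w [ i ]≔ lookup w j) (lookup w i)) (lookup∘update′ k≢i w (lookup w j))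

  -- The weight may depend on the position as well as on the letter, so one statement covers three
  -- counts: occurrences of a letter, bad positions and ascents.
  ∑-swap : (φ : Fin n → Fin σ → ℕ) → i ≢ j →
           ∃[ r ] (∑ (λ k → φ k (lookup w k)) ≡ (φ i (lookup w i) + φ j (lookup w j)) + r ×
                   ∑ (λ k → φ k (lookup (w ∘⟨ i , j ⟩) k)) ≡ (φ i (lookup w j) + φ j (lookup w i)) + r)
  ∑-swap φ i≢j with ∑-agree-off-two {g = λ k → φ k (lookup w k)} {λ k → φ k (lookup (w ∘⟨ i , j ⟩) k)} i≢j
                      (λ k k≢i k≢j → cong (φ k) (sym (lookup-swap-other k k≢i k≢j)))
  ... | r , before , after =
    r , before , trans after (cong (_+ r) (cong₂ _+_ (cong (φ i) (lookup-swapˡ i≢j)) (cong (φ j) lookup-swapʳ)))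

  parikh-swap : i ≢ j → parikh (w ∘⟨ i , j ⟩) ≡ parikh w
  parikh-swap i≢j = tabulate-cong λ a → let r , before , after = ∑-swap (λ _ x → 𝟙 (a ≟ x)) i≢j in begin
    count (a ≟_) (w ∘⟨ i , j ⟩)                           ≡⟨ count≡∑ a (w ∘⟨ i , j ⟩) ⟩
    ∑ (λ k → 𝟙 (a ≟ lookup (w ∘⟨ i , j ⟩) k))             ≡⟨ after ⟩
    (𝟙 (a ≟ lookup w j) + 𝟙 (a ≟ lookup w i)) + r         ≡⟨ cong (_+ r) (+-comm (𝟙 (a ≟ lookup w j)) _) ⟩
    (𝟙 (a ≟ lookup w i) + 𝟙 (a ≟ lookup w j)) + r         ≡⟨ before ⟨
    ∑ (λ k → 𝟙 (a ≟ lookup w k))                          ≡⟨ count≡∑ a w ⟨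
    count (a ≟_) w                                        ∎
    where open ≡-Reasoning

module _ {σ} {P : Vec ℕ σ} where

  -- Adjacency fixes only the underlying vector of a neighbour. Uniqueness of identity proofs takes
  -- care of the Parikh component.
  Word-≡ : {u v : Word P} → proj₁ u ≡ proj₁ v → u ≡ v
  Word-≡ {w , p} {.w , q} refl = cong (w ,_) (≡-irrelevant p q)

  swap : (w : Word P) {i j : Fin (sum P)} → i ≢ j → Word P
  swap (w , eq) {i} {j} i≢j = w ∘⟨ i , j ⟩ , trans (parikh-swap w i≢j) eq

  occurrences : (w : Word P) (a : Fin σ) → ∑ (λ i → 𝟙 (a ≟ lookup (proj₁ w) i)) ≡ lookup P a
  occurrences (w , eq) a = begin
    ∑ (λ i → 𝟙 (a ≟ lookup w i))  ≡⟨ count≡∑ a w ⟨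
    count (a ≟_) w                ≡⟨ lookup∘tabulate (λ b → count (b ≟_) w) a ⟨
    lookup (parikh w) a           ≡⟨ cong (λ Q → lookup Q a) eq ⟩
    lookup P a                    ∎
    where open ≡-Reasoning

  -- The letter of `v` at `i` occurs equally often in both words. Position `i` carries it in `v` but
  -- not in `u`, so some position must carry it in `u` but not in `v`.
  misplaced⇒∃ : (u v : Word P) (i : Fin (sum P)) → lookup (proj₁ u) i ≢ lookup (proj₁ v) i →
                ∃[ j ] (lookup (proj₁ u) j ≡ lookup (proj₁ v) i × lookup (proj₁ v) j ≢ lookup (proj₁ v) i)
  misplaced⇒∃ u@(x , _) v@(y , _) i xᵢ≢yᵢ =
    let a = lookup y i
        j , lt = ∑-≡⇒∃> (trans (occurrences u a) (sym (occurrences v a))) i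
                   (subst (_< 𝟙 (a ≟ lookup y i)) (sym (𝟙-false (a ≟ lookup x i) (xᵢ≢yᵢ ∘ sym)))
                     (≤-reflexive (sym (𝟙-true (a ≟ lookup y i) refl))))
        a≢yⱼ , a≡xⱼ = 𝟙-<⇒ (a ≟ lookup y j) (a ≟ lookup x j) lt
    in j , sym a≡xⱼ , a≢yⱼ ∘ sym

-- Upper bound

module _ {σ} {P : Vec ℕ σ} (a : Fin σ) (v : Word P) where

  private
    -- Phrased for a single letter `x` at position `i` instead of a whole word, which is the form of
    -- weight that `∑-swap` takes.
    Bad : Fin (sum P) → Fin σ → Set
    Bad i x = lookup (proj₁ v) i ≢ a × x ≢ lookup (proj₁ v) i

    bad? : ∀ i x → Dec (Bad i x)
    bad? i x = ¬? (lookup (proj₁ v) i ≟ a) ×-dec ¬? (x ≟ lookup (proj₁ v) i)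

  badness : Word P → ℕ
  badness u = ∑ (λ i → 𝟙 (bad? i (lookup (proj₁ u) i)))

  -- A mismatch at `i` is bad itself unless `v` has `a` there. In that case `u` has a copy of `a` at
  -- some `j` where `v` has another letter, and this `j` is bad.
  no-bad⇒≡ : (u : Word P) → ¬ (∃[ i ] Bad i (lookup (proj₁ u) i)) → u ≡ v
  no-bad⇒≡ u none = Word-≡ (lookup-ext (λ i → decidable-stable (_ ≟ _) (λ uᵢ≢vᵢ → impossible i uᵢ≢vᵢ)))
    where
    impossible : ∀ i → ¬ (lookup (proj₁ u) i ≢ lookup (proj₁ v) i)
    impossible i uᵢ≢vᵢ with lookup (proj₁ v) i ≟ a
    ... | no  vᵢ≢a = none (i , vᵢ≢a , uᵢ≢vᵢ)
    ... | yes vᵢ≡a =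
      let j , uⱼ≡vᵢ , vⱼ≢vᵢ = misplaced⇒∃ u v i uᵢ≢vᵢ
      in none (j , (λ vⱼ≡a → vⱼ≢vᵢ (trans vⱼ≡a (sym vᵢ≡a))) , (λ uⱼ≡vⱼ → vⱼ≢vᵢ (trans (sym uⱼ≡vⱼ) uⱼ≡vᵢ)))

  repair : (u : Word P) → (∃[ i ] Bad i (lookup (proj₁ u) i)) →
           ∃[ u′ ] (ConfigurationGraph P u u′ × badness u′ < badness u)
  repair u (i , vᵢ≢a , uᵢ≢vᵢ) with misplaced⇒∃ u v i uᵢ≢vᵢ
  ... | j , uⱼ≡vᵢ , vⱼ≢vᵢ = swap u i≢j , (i , j , i≢j , uᵢ≢uⱼ , refl) , decrease
    where
    uᵢ = lookup (proj₁ u) i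
    uⱼ = lookup (proj₁ u) j

    i≢j : i ≢ j
    i≢j refl = vⱼ≢vᵢ refl

    uᵢ≢uⱼ : uᵢ ≢ uⱼ
    uᵢ≢uⱼ eq = uᵢ≢vᵢ (trans eq uⱼ≡vᵢ)

    decrease : badness (swap u i≢j) < badness u
    decrease with ∑-swap (proj₁ u) (λ k x → 𝟙 (bad? k x)) i≢j
    ... | r , before , after = begin-strict
      badness (swap u i≢j)                          ≡⟨ after ⟩
      (𝟙 (bad? i uⱼ) + 𝟙 (bad? j uᵢ)) + r           <⟨ ℕ.+-monoˡ-< r (+-mono-<-≤ fixed unspoilt) ⟩
      (𝟙 (bad? i uᵢ) + 𝟙 (bad? j uⱼ)) + r           ≡⟨ before ⟨
      badness u                                     ∎
      where
      open ≤-Reasoning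
      fixed : 𝟙 (bad? i uⱼ) < 𝟙 (bad? i uᵢ)
      fixed = subst (_< 𝟙 (bad? i uᵢ)) (sym (𝟙-false (bad? i uⱼ) (λ bad → proj₂ bad uⱼ≡vᵢ)))
                (≤-reflexive (sym (𝟙-true (bad? i uᵢ) (vᵢ≢a , uᵢ≢vᵢ))))
      unspoilt : 𝟙 (bad? j uᵢ) ≤ 𝟙 (bad? j uⱼ)
      -- Position `j` is already wrong before the swap, since `uⱼ ≡ vᵢ` and `vⱼ ≢ vᵢ`. If it is bad
      -- afterwards, then `vⱼ ≢ a`, so it was bad before.
      unspoilt = 𝟙-mono (bad? j uᵢ) (bad? j uⱼ)
                   (λ (vⱼ≢a , _) → vⱼ≢a , λ uⱼ≡vⱼ → vⱼ≢vᵢ (trans (sym uⱼ≡vⱼ) uⱼ≡vᵢ))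

  -- The positions where `v` has `a` are never bad, and there are `lookup P a` of them. The bound is
  -- therefore best when `a` is a most frequent letter.
  badness≤ : (u : Word P) → badness u ≤ sum P ∸ lookup P a
  badness≤ u = begin
    badness u                                  ≡⟨ m+n∸n≡m (badness u) (lookup P a) ⟨
    badness u + lookup P a ∸ lookup P a        ≡⟨ cong (λ x → badness u + x ∸ lookup P a) (occurrences v a) ⟨
    badness u + ∑ isA ∸ lookup P a             ≡⟨ cong (_∸ lookup P a) (∑-distrib-+ _ isA) ⟨
    ∑ (λ i → isBad i + isA i) ∸ lookup P a     ≤⟨ ℕ.∸-monoˡ-≤ (lookup P a) (∑-mono-≤ disjoint) ⟩
    ∑ {sum P} (λ _ → 1) ∸ lookup P a           ≡⟨ cong (_∸ lookup P a) (∑-ones (sum P)) ⟩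
    sum P ∸ lookup P a                         ∎
    where
    open ≤-Reasoning
    isA isBad : Fin (sum P) → ℕ
    isA i = 𝟙 (a ≟ lookup (proj₁ v) i)
    isBad i = 𝟙 (bad? i (lookup (proj₁ u) i))
    disjoint : ∀ i → isBad i + isA i ≤ 1
    disjoint i with a ≟ lookup (proj₁ v) i
    ... | yes a≡vᵢ = ≤-reflexive (cong (_+ 1) (𝟙-false (bad? i (lookup (proj₁ u) i)) (λ bad → proj₁ bad (sym a≡vᵢ))))
    ... | no  _    = ≤-trans (≤-reflexive (+-identityʳ _)) (𝟙≤1 (bad? i (lookup (proj₁ u) i)))

  -- The recursion is on the bound `b` and not on the badness itself, because one swap may repair
  -- two positions at once.
  walk-≤-badness : ∀ b (u : Word P) → badness u ≤ b →
                   Σ[ p ∈ Walk (ConfigurationGraph P) u v ] walkLength (ConfigurationGraph P) p ≤ b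
  walk-≤-badness b u u≤b with any? (λ i → bad? i (lookup (proj₁ u) i))
  ... | no none with refl ← no-bad⇒≡ u none = ε , z≤n
  walk-≤-badness b u u≤b | yes bad with repair u bad
  walk-≤-badness zero    u u≤b | yes bad | u′ , _ , u′<u = contradiction (<-≤-trans u′<u u≤b) (λ ())
  walk-≤-badness (suc b) u u≤b | yes bad | u′ , e , u′<u =
    let p , p≤b = walk-≤-badness b u′ (ℕ.≤-pred (<-≤-trans u′<u u≤b)) in e ◅ p , s≤s p≤b

  short-walk : (u : Word P) → Σ[ p ∈ Walk (ConfigurationGraph P) u v ] walkLength (ConfigurationGraph P) p ≤ sum P ∸ lookup P a
  short-walk u = walk-≤-badness (sum P ∸ lookup P a) u (badness≤ u)

-- Existence of distances

module _ {V : Set} (_~_ : Rel V 0ℓ) (_≟ⱽ_ : DecidableEquality V)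
         (step? : ∀ {Q : V → Set} → (∀ v → Dec (Q v)) → ∀ u → Dec (∃[ v ] (u ~ v × Q v))) where

  -- A walk of length `suc k` is a step followed by a walk of length `k`. The search through
  -- neighbours is delegated to `step?`, which expresses finite branching.
  walkOfLength? : ∀ k u v → Dec (Σ[ p ∈ Walk _~_ u v ] walkLength _~_ p ≡ k)
  walkOfLength? zero    u v = map′ (λ where refl → ε , refl) (λ where (ε , _) → refl) (u ≟ⱽ v)
  walkOfLength? (suc k) u v = map′ (λ (_ , e , p , eq) → e ◅ p , cong suc eq) (λ where (e ◅ p , refl) → _ , e , p , refl)
                                (step? (λ w → walkOfLength? k w v) u)

  -- Constructive search for a shortest walk: it is decidable whether a strictly shorter one exists.
  -- If so, well-founded recursion continues from it; if not, the present length is the distance.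
  walk⇒distance : ∀ {u v} (p : Walk _~_ u v) → ∃[ d ] (IsDistance _~_ u v d × d ≤ walkLength _~_ p)
  walk⇒distance {u} {v} p = <-rec Goal shorten (walkLength _~_ p) p refl
    where
    Goal : ℕ → Set
    Goal k = (p : Walk _~_ u v) → walkLength _~_ p ≡ k → ∃[ d ] (IsDistance _~_ u v d × d ≤ k)

    shorten : ∀ k → (∀ {l} → l < k → Goal l) → Goal k
    shorten k rec p eq with anyUpTo? (λ l → walkOfLength? l u v) k
    ... | yes (l , l<k , q , q≡l) = let d , isD , d≤l = rec l<k q q≡l in d , isD , ≤-trans d≤l (ℕ.<⇒≤ l<k)
    ... | no none = k , ((p , eq) , λ q → ≮⇒≥ (λ q<k → none (_ , q<k , q , refl))) , ≤-refl

module _ {σ} (P : Vec ℕ σ) where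

  _≟ʷ_ : DecidableEquality (Word P)
  u ≟ʷ v = map′ Word-≡ (cong proj₁) (≡-dec _≟_ (proj₁ u) (proj₁ v))

  -- Every neighbour of `u` arises from a pair of positions, so it suffices to search the finitely
  -- many pairs.
  swapStep? : ∀ {Q : Word P → Set} → (∀ v → Dec (Q v)) → ∀ u → Dec (∃[ v ] (ConfigurationGraph P u v × Q v))
  swapStep? {Q} Q? u = map′
    (λ (i , j , i≢j , uᵢ≢uⱼ , q) → swap u i≢j , (i , j , i≢j , uᵢ≢uⱼ , refl) , q)
    (λ (v , (i , j , i≢j , uᵢ≢uⱼ , eq) , q) → i , j , i≢j , uᵢ≢uⱼ , subst Q (Word-≡ eq) q)
    (any? λ i → any? λ j → admissible? i j)
    where
    Admissible : Fin (sum P) → Fin (sum P) → Set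
    Admissible i j = Σ[ i≢j ∈ i ≢ j ] (lookup (proj₁ u) i ≢ lookup (proj₁ u) j × Q (swap u i≢j))

    admissible? : ∀ i j → Dec (Admissible i j)
    admissible? i j with i ≟ j
    ... | yes i≡j = no (λ (i≢j , _) → i≢j i≡j)
    -- The given proof of `Q` may concern the swap built from another proof of `i ≢ j`; both swaps
    -- have the same underlying vector.
    ... | no  i≢j = map′ (i≢j ,_) (λ (i≢j′ , uᵢ≢uⱼ , q) → uᵢ≢uⱼ , subst Q (Word-≡ refl) q)
                      (¬? (lookup (proj₁ u) i ≟ lookup (proj₁ u) j) ×-dec Q? (swap u i≢j))

-- Lower bound

ascents : ∀ {σ n} → Vec (Fin σ) n → Vec (Fin σ) n → ℕ
ascents u v = ∑ (λ i → 𝟙 (lookup u i <? lookup v i))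

ascents-diagonal : ∀ {σ n} (v : Vec (Fin σ) n) → ascents v v ≡ 0
ascents-diagonal []      = refl
ascents-diagonal (x ∷ v) = cong₂ _+_ (𝟙-false (x <? x) (<-irrefl refl)) (ascents-diagonal v)

-- One of the two positions receives a letter no larger than its old one and so keeps its ascent, if
-- it had one. Only the ascent at the other position can be lost.
ascents-swap : ∀ {σ n} (u v : Vec (Fin σ) n) {i j} → i ≢ j → ascents u v ≤ suc (ascents (u ∘⟨ i , j ⟩) v)
ascents-swap u v {i} {j} i≢j with ∑-swap u (λ k x → 𝟙 (x <? lookup v k)) i≢j
... | r , before , after = begin
  ascents u v                                   ≡⟨ before ⟩
  (asc i uᵢ + asc j uⱼ) + r                     ≤⟨ +-monoˡ-≤ r (exchange (≤-total uᵢ uⱼ)) ⟩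
  suc (asc i uⱼ + asc j uᵢ) + r                 ≡⟨ cong suc after ⟨
  suc (ascents (u ∘⟨ i , j ⟩) v)                ∎
  where
  open ≤-Reasoning
  uᵢ = lookup u i
  uⱼ = lookup u j
  asc : Fin _ → Fin _ → ℕ
  asc k x = 𝟙 (x <? lookup v k)
  asc≤1 : ∀ k x → asc k x ≤ 1
  asc≤1 k x = 𝟙≤1 (x <? lookup v k)
  antitone : ∀ k {x y} → x ≤ᶠ y → asc k y ≤ asc k x
  antitone k {x} {y} x≤y = 𝟙-mono (y <? lookup v k) (x <? lookup v k) (≤-<-trans x≤y)
  exchange : uᵢ ≤ᶠ uⱼ ⊎ uⱼ ≤ᶠ uᵢ → asc i uᵢ + asc j uⱼ ≤ suc (asc i uⱼ + asc j uᵢ)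
  exchange (inj₁ uᵢ≤uⱼ) = +-mono-≤ (asc≤1 i uᵢ) (≤-trans (antitone j uᵢ≤uⱼ) (ℕ.m≤n+m _ (asc i uⱼ)))
  exchange (inj₂ uⱼ≤uᵢ) = begin
    asc i uᵢ + asc j uⱼ        ≤⟨ +-mono-≤ (antitone i uⱼ≤uᵢ) (≤-trans (asc≤1 j uⱼ) (s≤s z≤n)) ⟩
    asc i uⱼ + suc (asc j uᵢ)  ≡⟨ +-suc (asc i uⱼ) (asc j uᵢ) ⟩
    suc (asc i uⱼ + asc j uᵢ)  ∎

ascents≤walkLength : ∀ {σ} {P : Vec ℕ σ} {u v : Word P} (p : Walk (ConfigurationGraph P) u v) →
                     ascents (proj₁ u) (proj₁ v) ≤ walkLength (ConfigurationGraph P) p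
ascents≤walkLength {u = u} ε = ≤-reflexive (ascents-diagonal (proj₁ u))
ascents≤walkLength {u = u} {v} (_◅_ {j = u′} (i , j , i≢j , _ , eq) p) = begin
  ascents (proj₁ u) (proj₁ v)                        ≤⟨ ascents-swap (proj₁ u) (proj₁ v) i≢j ⟩
  suc (ascents (proj₁ u ∘⟨ i , j ⟩) (proj₁ v))       ≡⟨ cong (λ w → suc (ascents w (proj₁ v))) eq ⟨
  suc (ascents (proj₁ u′) (proj₁ v))                 ≤⟨ s≤s (ascents≤walkLength p) ⟩
  suc (walkLength _ p)                               ∎
  where open ≤-Reasoning

-- Letter counts in lists

multiplicity : ∀ {σ} → Fin σ → List (Fin σ) → ℕ
multiplicity a xs = length (filter (a ≟_) xs)

multiplicity-++ : ∀ {σ} (a : Fin σ) xs ys → multiplicity a (xs ++ ys) ≡ multiplicity a xs + multiplicity a ys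
multiplicity-++ a xs ys = trans (cong length (filter-++ (a ≟_) xs ys)) (length-++ (filter (a ≟_) xs))

multiplicity-map-suc : ∀ {σ} (a : Fin σ) xs → multiplicity (suc a) (List.map suc xs) ≡ multiplicity a xs
multiplicity-map-suc a []       = refl
multiplicity-map-suc a (x ∷ xs) with does (a ≟ x)
... | true  = cong suc (multiplicity-map-suc a xs)
... | false = multiplicity-map-suc a xs

count-fromList : ∀ {σ n} (a : Fin σ) xs (eq : length xs ≡ n) → count (a ≟_) (cast eq (fromList xs)) ≡ multiplicity a xs
count-fromList a []       refl = refl
count-fromList a (x ∷ xs) refl with does (a ≟ x)
... | true  = cong suc (count-fromList a xs refl)
... | false = count-fromList a xs refl

-- The extremal words are built as lists, where `take`, `drop` and `++` bring no length arithmetic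
-- into the types. They become vectors of length `sum P` only here.
toWord : ∀ {σ} {P : Vec ℕ σ} (xs : List (Fin σ)) → length xs ≡ sum P → (∀ a → multiplicity a xs ≡ lookup P a) → Word P
toWord {P = P} xs eq mult =
  cast eq (fromList xs) , trans (tabulate-cong (λ a → trans (count-fromList a xs eq) (mult a))) (tabulate∘lookup P)

-- The sorted word and its rotation

sortedWord : ∀ {σ} → Vec ℕ σ → List (Fin σ)
sortedWord []      = []
sortedWord (p ∷ P) = replicate p zero ++ List.map suc (sortedWord P)

length-sortedWord : ∀ {σ} (P : Vec ℕ σ) → length (sortedWord P) ≡ sum P
length-sortedWord []      = refl
length-sortedWord (p ∷ P) = trans (length-++ (replicate p zero))
  (cong₂ _+_ (length-replicate p) (trans (length-map suc (sortedWord P)) (length-sortedWord P)))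

multiplicity-sortedWord : ∀ {σ} (P : Vec ℕ σ) a → multiplicity a (sortedWord P) ≡ lookup P a
multiplicity-sortedWord (p ∷ P) zero = begin
  multiplicity zero (replicate p zero ++ List.map suc (sortedWord P))                 ≡⟨ multiplicity-++ zero (replicate p zero) _ ⟩
  multiplicity zero (replicate p zero) + multiplicity zero (List.map suc (sortedWord P)) ≡⟨ cong₂ _+_ (cong length (filter-all (zero ≟_) (All.replicate⁺ p refl))) (cong length (filter-none (zero ≟_) (All.map⁺ (All.universal (λ _ ()) (sortedWord P))))) ⟩
  length (replicate p (zero {_})) + 0                                                 ≡⟨ +-identityʳ _ ⟩
  length (replicate p zero)                                                           ≡⟨ length-replicate p ⟩
  p                                                                                   ∎
  where open ≡-Reasoning
multiplicity-sortedWord (p ∷ P) (suc a) = begin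
  multiplicity (suc a) (replicate p zero ++ List.map suc (sortedWord P))                    ≡⟨ multiplicity-++ (suc a) (replicate p zero) _ ⟩
  multiplicity (suc a) (replicate p zero) + multiplicity (suc a) (List.map suc (sortedWord P)) ≡⟨ cong₂ _+_ (cong length (filter-none (suc a ≟_) (All.replicate⁺ p (λ ())))) (multiplicity-map-suc a (sortedWord P)) ⟩
  multiplicity a (sortedWord P)                                                             ≡⟨ multiplicity-sortedWord P a ⟩
  lookup P a                                                                                ∎
  where open ≡-Reasoning

rotate : {A : Set} → ℕ → List A → List A
rotate m xs = drop m xs ++ take m xs

length-rotate : {A : Set} (m : ℕ) (xs : List A) → length (rotate m xs) ≡ length xs
length-rotate m xs = begin
  length (drop m xs ++ take m xs)          ≡⟨ length-++ (drop m xs) ⟩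
  length (drop m xs) + length (take m xs)  ≡⟨ +-comm (length (drop m xs)) _ ⟩
  length (take m xs) + length (drop m xs)  ≡⟨ length-++ (take m xs) ⟨
  length (take m xs ++ drop m xs)          ≡⟨ cong length (take++drop≡id m xs) ⟩
  length xs                                ∎
  where open ≡-Reasoning

multiplicity-rotate : ∀ {σ} (a : Fin σ) m xs → multiplicity a (rotate m xs) ≡ multiplicity a xs
multiplicity-rotate a m xs = begin
  multiplicity a (drop m xs ++ take m xs)                ≡⟨ multiplicity-++ a (drop m xs) _ ⟩
  multiplicity a (drop m xs) + multiplicity a (take m xs)  ≡⟨ +-comm (multiplicity a (drop m xs)) _ ⟩
  multiplicity a (take m xs) + multiplicity a (drop m xs)  ≡⟨ multiplicity-++ a (take m xs) _ ⟨
  multiplicity a (take m xs ++ drop m xs)                ≡⟨ cong (multiplicity a) (take++drop≡id m xs) ⟩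
  multiplicity a xs                                      ∎
  where open ≡-Reasoning

-- Only the common prefix of the two lists is compared, as zip truncates.
Ascending : ∀ {σ} → List (Fin σ) → List (Fin σ) → Set
Ascending xs ys = All (uncurry _<ᶠ_) (zip xs ys)

-- The block of zeros faces only nonzero letters of `ys`; after it, `xs` faces what remains of `ys`.
-- If `ys` ends within the block, nothing is left to compare.
ascending-replicate-++ : ∀ {σ} p {xs ys : List (Fin (suc σ))} → All (zero {σ} <ᶠ_) ys → Ascending xs (drop p ys) →
                         Ascending (replicate p zero ++ xs) ys
ascending-replicate-++ zero    _          asc = asc
ascending-replicate-++ (suc p) []         _   = []
ascending-replicate-++ (suc p) (0<y ∷ ys) asc = 0<y ∷ ascending-replicate-++ p ys asc

ascending-map-suc : ∀ {σ} (xs ys : List (Fin σ)) → Ascending xs ys → Ascending (List.map suc xs) (List.map suc ys)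
ascending-map-suc []       _        _           = []
ascending-map-suc (_ ∷ _)  []       _           = []
ascending-map-suc (_ ∷ xs) (_ ∷ ys) (x<y ∷ asc) = s≤s x<y ∷ ascending-map-suc xs ys asc

drop-replicate-++ : {A : Set} {x : A} (p k : ℕ) (ys : List A) → drop (p + k) (replicate p x ++ ys) ≡ drop k ys
drop-replicate-++ zero    k ys = refl
drop-replicate-++ (suc p) k ys = drop-replicate-++ p k ys

-- Stated for every `m` above the maximum, because the induction keeps `m` while the maximum of the
-- tail may be smaller. As `p ≤ m`, dropping `m` letters removes all zeros, so the leading block of
-- zeros meets only larger letters.
sortedWord-ascending : ∀ {σ} (P : Vec ℕ σ) {m} → maximum P ≤ m → Ascending (sortedWord P) (drop m (sortedWord P))
sortedWord-ascending []      _         = []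
sortedWord-ascending (p ∷ P) {m} max≤m =
  subst (Ascending (replicate p zero ++ S)) (sym shifted)
    (ascending-replicate-++ p (All.map⁺ (All.universal (λ _ → s≤s z≤n) (drop k (sortedWord P))))
      (subst (Ascending S) (sym rest) (ascending-map-suc _ _ (sortedWord-ascending P (m⊔n≤o⇒n≤o p _ max≤m)))))
  where
  open ≡-Reasoning
  S = List.map suc (sortedWord P)
  k = m ∸ p

  p+k≡m : p + k ≡ m
  p+k≡m = m+[n∸m]≡n (m⊔n≤o⇒m≤o p _ max≤m)

  shifted : drop m (replicate p zero ++ S) ≡ List.map suc (drop k (sortedWord P))
  shifted = begin
    drop m (replicate p zero ++ S)        ≡⟨ cong (λ l → drop l (replicate p zero ++ S)) p+k≡m ⟨
    drop (p + k) (replicate p zero ++ S)  ≡⟨ drop-replicate-++ p k S ⟩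
    drop k S                              ≡⟨ drop-map k (sortedWord P) ⟩
    List.map suc (drop k (sortedWord P))  ∎

  -- Beyond the zero block, `m ∸ p` letters of the tail are already dropped and `p` more are
  -- skipped. The tail is thus again compared with itself shifted by `m`, as the induction
  -- hypothesis requires.
  rest : drop p (List.map suc (drop k (sortedWord P))) ≡ List.map suc (drop m (sortedWord P))
  rest = begin
    drop p (List.map suc (drop k (sortedWord P)))  ≡⟨ drop-map p (drop k (sortedWord P)) ⟩
    List.map suc (drop p (drop k (sortedWord P)))  ≡⟨ cong (List.map suc) (drop-drop k p (sortedWord P)) ⟩
    List.map suc (drop (k + p) (sortedWord P))     ≡⟨ cong (λ l → List.map suc (drop l (sortedWord P))) (trans (+-comm k p) p+k≡m) ⟩
    List.map suc (drop m (sortedWord P))           ∎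

-- The two length equations make `ys` no longer than `xs`, so the truncation by `zip` in `Ascending`
-- loses no position of `ys`. The positions of `zs` are bounded below by zero.
length≤ascents : ∀ {σ n} (xs ys zs : List (Fin σ)) (eq : length xs ≡ n) (eq′ : length (ys ++ zs) ≡ n) → Ascending xs ys →
                 length ys ≤ ascents (cast eq (fromList xs)) (cast eq′ (fromList (ys ++ zs)))
length≤ascents xs       []       zs eq   eq′ asc         = z≤n
length≤ascents (x ∷ xs) (y ∷ ys) zs refl eq′ (x<y ∷ asc) =
  +-mono-≤ (≤-reflexive (sym (𝟙-true (x <? y) x<y))) (length≤ascents xs ys zs refl (ℕ.suc-injective eq′) asc)
length≤ascents []       (y ∷ ys) zs refl ()  asc

far-apart : ∀ {σ} (P : Vec ℕ σ) → Σ[ u ∈ Word P ] Σ[ v ∈ Word P ] sum P ∸ maximum P ≤ ascents (proj₁ u) (proj₁ v)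
far-apart P =
  toWord w lenʷ (multiplicity-sortedWord P) ,
  toWord (rotate m w) lenʳ (λ a → trans (multiplicity-rotate a m w) (multiplicity-sortedWord P a)) ,
  (begin
    sum P ∸ m         ≡⟨ cong (_∸ m) lenʷ ⟨
    length w ∸ m      ≡⟨ length-drop m w ⟨
    -- The rotation is `drop m w ++ take m w` by definition. Ascents are claimed only on its first
    -- part, not on the letters that wrap around.
    length (drop m w) ≤⟨ length≤ascents w (drop m w) (take m w) lenʷ lenʳ (sortedWord-ascending P ≤-refl) ⟩
    _                 ∎)
  where
  open ≤-Reasoning
  m = maximum P
  w = sortedWord P
  lenʷ : length w ≡ sum P
  lenʷ = length-sortedWord P
  lenʳ : length (rotate m w) ≡ sum P
  lenʳ = trans (length-rotate m w) lenʷ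

-- The diameter from the two bounds

maximum-attained : ∀ {σ} (P : Vec ℕ (suc σ)) → ∃[ a ] lookup P a ≡ maximum P
maximum-attained (p ∷ [])        = zero , sym (ℕ.⊔-identityʳ p)
maximum-attained (p ∷ P@(_ ∷ _)) with ⊔-sel p (maximum P)
... | inj₁ eq = zero , sym eq
... | inj₂ eq = let a , eqₐ = maximum-attained P in suc a , trans eqₐ (sym eq)

theorem1 : (σ : ℕ) (P : Vec ℕ σ) → sum P ≥ 1 → IsDiameter (ConfigurationGraph P) (sum P ∸ maximum P)
-- Over the empty alphabet `sum P` is 0. A nonempty alphabet provides the letter at which
-- `maximum P` is attained.
theorem1 zero    [] ()
theorem1 (suc σ) P  _ = connected , extremal
  where
  G = ConfigurationGraph P
  D = sum P ∸ maximum P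

  walk : ∀ u v → Σ[ p ∈ Walk G u v ] walkLength G p ≤ D
  walk u v = let a , eq = maximum-attained P
             in subst (λ m → Σ[ p ∈ Walk G u v ] walkLength G p ≤ sum P ∸ m) eq (short-walk a v u)

  connected : ∀ u v → ∃[ d ] (IsDistance G u v d × d ≤ D)
  connected u v = let p , p≤D = walk u v
                      d , isD , d≤p = walk⇒distance G (_≟ʷ_ P) (swapStep? P) p
                  in d , isD , ≤-trans d≤p p≤D

  extremal : ∃[ u ] ∃[ v ] IsDistance G u v D
  -- The upper bound supplies a walk of length at most `D` between the two words, and their ascents
  -- force every walk to have length at least `D`. So this walk has length exactly `D` and is
  -- shortest.
  extremal = let u , v , D≤asc = far-apart P
                 p , p≤D = walk u v
                 D≤ = λ q → ≤-trans D≤asc (ascents≤walkLength {P = P} {u} {v} q)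
             in u , v , (p , ≤-antisym p≤D (D≤ p)) , D≤
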